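{- Let $f,g:\{0,1\}^n\to\{0,1\}$ be Boolean functions. If $f$ is PN-equivalent to $g$, then they have the same average sensitivity: $\widehat{s(f)}=\widehat{s(g)}$.
   Context: For a word $x=(x_1,\dots,x_n)\in\{0,1\}^n$ and an index $i$, $x^i$ denotes the word obtained from $x$ by changing (flipping) its $i$-th bit. The (local) sensitivity of $f$ on $x$ is $s(f,x)=|\{i\in\{1,\dots,n\}: f(x)\neq f(x^i)\}|$. The average sensitivity of $f$ is $\widehat{s(f)}=\frac{1}{2^n}\sum_{x\in\{0,1\}^n}s(f,x)$. PN-equivalence: $f$ is PN-equivalent to $g$ if there exist a permutation $\pi$ of the $n$ coordinates (acting on words by permuting their bits) and, for each coordinate $j$, a choice of whether or not to negate it (written $(\neg)x_j$, the choice being independent of $x$), such that $f(\pi((\neg)x_1,(\neg)x_2,\dots,(\neg)x_n))=g(x_1,\dots,x_n)$ for all $x\in\{0,1\}^n$. -}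

module Defs where

open import Data.Bool using (Bool; true; false; not; _xor_; _≟_)
open import Data.Fin using (Fin)
open import Data.Fin.Permutation using (Permutation′; _⟨$⟩ʳ_)
open import Data.Integer using (+_)
open import Data.List as List using (List; _++_)
open import Data.Nat using (ℕ; zero; suc; _^_)
open import Data.Nat.ListAction using (sum)
open import Data.Nat.Properties using (m^n≢0)
open import Data.Product using (∃-syntax)
open import Data.Rational using (ℚ; _/_)
open import Data.Vec using (Vec; []; _∷_; allFin; count; lookup; tabulate; updateAt; zipWith)
open import Relation.Binary.PropositionalEquality using (_≡_)
open import Relation.Nullary using (¬?)

Word : ℕ → Set
Word n = Vec Bool n

BooleanFunction : ℕ → Set
BooleanFunction n = Word n → Bool

flip : ∀ {n} → Word n → Fin n → Word n
flip x i = updateAt x i not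

sensitivity : ∀ {n} → BooleanFunction n → Word n → ℕ
sensitivity {n} f x = count (λ i → ¬? (f x ≟ f (flip x i))) (allFin n)

-- Every word of length n, each listed exactly once.
words : ∀ n → List (Word n)
words zero    = [] List.∷ List.[]
words (suc n) = List.map (false ∷_) (words n) ++ List.map (true ∷_) (words n)

averageSensitivity : ∀ {n} → BooleanFunction n → ℚ
averageSensitivity {n} f = + sum (List.map (sensitivity f) (words n)) / (2 ^ n)
  where instance _ = m^n≢0 2 n

permute : ∀ {n} → Permutation′ n → Word n → Word n
permute π x = tabulate (λ i → lookup x (π ⟨$⟩ʳ i))

-- The mask ν selects the coordinates to negate: true xor b = not b and
-- false xor b = b.
negate : ∀ {n} → Vec Bool n → Word n → Word n
negate ν x = zipWith _xor_ ν x

PNEquivalent : ∀ {n} → BooleanFunction n → BooleanFunction n → Set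
PNEquivalent {n} f g =
  ∃[ π ] ∃[ ν ] (∀ (x : Word n) → f (permute π (negate ν x)) ≡ g x)

{-# OPTIONS --safe #-}
module Submission where

-- Write T x = π((¬)x).  T is a bijection of the cube that sends the edge
-- {x, x^{π j}} to the edge {T x, (T x)^j}.  Hence g = f ∘ T has sensitivity
-- s(g, x) = s(f, T x), and summing over all x permutes the terms.

open import Defs
open import Data.Bool using (Bool; true; false; not; _xor_; if_then_else_; _≟_)
open import Data.Bool.Properties using (xor-assoc; xor-same; not-distribʳ-xor)
open import Data.Empty using (⊥)
open import Data.Fin using (Fin; zero; suc)
import Data.Fin.Properties as Fin
open import Data.Fin.Permutation as Perm
  using (Permutation′; _⟨$⟩ʳ_; _⟨$⟩ˡ_; inverseˡ)
open import Data.Integer using (+_)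
import Data.List as List
open import Data.List.Membership.Propositional using (_∈_)
open import Data.List.Membership.Propositional.Properties
  using (∈-map⁺; ∈-map⁻; ∈-++⁺ˡ; ∈-++⁺ʳ)
open import Data.List.Membership.Propositional.Properties.WithK using (unique∧set⇒bag)
import Data.List.Properties as List
open import Data.List.Relation.Binary.BagAndSetEquality using (∼bag⇒↭)
open import Data.List.Relation.Binary.Permutation.Propositional using (_↭_)
import Data.List.Relation.Binary.Permutation.Propositional.Properties as ↭
open import Data.List.Relation.Unary.All using ([])
open import Data.List.Relation.Unary.AllPairs using ([]; _∷_)
open import Data.List.Relation.Unary.Any using (here)
open import Data.List.Relation.Unary.Unique.Propositional using (Unique)
import Data.List.Relation.Unary.Unique.Propositional.Properties as Unique
open import Data.Nat using (ℕ; zero; suc; _^_)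
open import Data.Nat.ListAction using (sum)
open import Data.Nat.ListAction.Properties using (sum-↭)
open import Data.Nat.Properties using (+-0-commutativeMonoid; m^n≢0)
open import Data.Product using (∃; _×_; _,_)
open import Data.Rational using (_/_)
open import Data.Vec using (Vec; []; _∷_; count; lookup; tabulate)
open import Data.Vec.Properties
  using (∷-injectiveʳ; lookup∘tabulate; lookup∘updateAt; lookup∘updateAt′;
         tabulate∘lookup; tabulate-cong)
open import Function using (_∘_; id; mk⇔; Injective; StrictlySurjective)
open import Function.Bundles using (Injection)
open import Function.Properties.Inverse using (↔⇒↣)
open import Relation.Binary.PropositionalEquality
  using (_≡_; _≗_; refl; sym; trans; cong; cong₂; module ≡-Reasoning)
open import Relation.Nullary using (does; yes; no; ¬?)
open import Relation.Unary using (Pred; Decidable)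
open import Algebra.Properties.CommutativeMonoid.Sum +-0-commutativeMonoid
  using (sum-permute; sum-cong-≗) renaming (sum to ∑)

open ≡-Reasoning

lookup-extensional : ∀ {a} {A : Set a} {n} {xs ys : Vec A n} →
  lookup xs ≗ lookup ys → xs ≡ ys
lookup-extensional {xs = xs} {ys} eq =
  trans (sym (tabulate∘lookup xs)) (trans (tabulate-cong eq) (tabulate∘lookup ys))

-- Recasting the count as a sum in a commutative monoid makes it possible to reindex by a
-- permutation with `sum-permute`.
count-tabulate : ∀ {a p} {A : Set a} {P : Pred A p} (P? : Decidable P) {n} (h : Fin n → A) →
  count P? (tabulate h) ≡ ∑ (λ i → if does (P? (h i)) then 1 else 0)
count-tabulate P? {zero}  h = refl
count-tabulate P? {suc n} h with does (P? (h zero))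
... | true  = cong suc (count-tabulate P? (h ∘ suc))
... | false = count-tabulate P? (h ∘ suc)

differ : Bool → Bool → ℕ
differ a b = if does (¬? (a ≟ b)) then 1 else 0

sensitivity-∑ : ∀ {n} (f : BooleanFunction n) x →
  sensitivity f x ≡ ∑ (λ i → differ (f x) (f (flip x i)))
sensitivity-∑ f x = count-tabulate (λ i → ¬? (f x ≟ f (flip x i))) id

words-unique : ∀ n → Unique (words n)
words-unique zero    = [] ∷ []
words-unique (suc n) = Unique.++⁺
  (Unique.map⁺ ∷-injectiveʳ (words-unique n))
  (Unique.map⁺ ∷-injectiveʳ (words-unique n))
  -- The two halves share no word, since their first bits differ.
  λ { (p , q) → disjoint (∈-map⁻ _ p) (∈-map⁻ _ q) }
  where
  disjoint : ∀ {v} → ∃ (λ x → x ∈ words n × v ≡ false ∷ x) →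
             ∃ (λ x → x ∈ words n × v ≡ true ∷ x) → ⊥
  disjoint (_ , _ , refl) (_ , _ , ())

∈-words : ∀ {n} (x : Word n) → x ∈ words n
∈-words []                 = here refl
∈-words (false ∷ x)        = ∈-++⁺ˡ (∈-map⁺ _ (∈-words x))
∈-words {suc n} (true ∷ x) = ∈-++⁺ʳ (List.map (false ∷_) (words n)) (∈-map⁺ _ (∈-words x))

-- Two duplicate-free lists with the same members are permutations of each other. Injectivity of `T`
-- keeps the image list duplicate-free, and surjectivity puts every word into it; `words n` has both
-- properties already.
map-words-↭ : ∀ {n} {T : Word n → Word n} →
  Injective _≡_ _≡_ T → StrictlySurjective _≡_ T → List.map T (words n) ↭ words n
map-words-↭ {n} {T} inj surj = ∼bag⇒↭ (unique∧set⇒bag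
  (Unique.map⁺ inj (words-unique n)) (words-unique n)
  (mk⇔ (λ _ → ∈-words _) (λ _ → ∈-image _)))
  where
  ∈-image : ∀ y → y ∈ List.map T (words n)
  ∈-image y with surj y
  ... | x , refl = ∈-map⁺ T (∈-words x)

negate-involutive : ∀ {n} (ν x : Word n) → negate ν (negate ν x) ≡ x
negate-involutive []      []      = refl
negate-involutive (b ∷ ν) (c ∷ x) = cong₂ _∷_
  (trans (sym (xor-assoc b b c)) (cong (_xor c) (xor-same b)))
  (negate-involutive ν x)

negate-flip : ∀ {n} (ν x : Word n) i → negate ν (flip x i) ≡ flip (negate ν x) i
negate-flip (b ∷ ν) (c ∷ x) zero    = cong (_∷ negate ν x) (sym (not-distribʳ-xor b c))
negate-flip (b ∷ ν) (c ∷ x) (suc i) = cong ((b xor c) ∷_) (negate-flip ν x i)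

-- `Perm.flip` inverts a permutation and is unrelated to the bit flip `flip`. Position `i` reads
-- position `π i` of the inner word, which in turn reads position `i` of `x`.
permute-inverseʳ : ∀ {n} (π : Permutation′ n) x → permute π (permute (Perm.flip π) x) ≡ x
permute-inverseʳ π x = lookup-extensional λ i → begin
  lookup (permute π (permute (Perm.flip π) x)) i  ≡⟨ lookup∘tabulate _ i ⟩
  lookup (permute (Perm.flip π) x) (π ⟨$⟩ʳ i)      ≡⟨ lookup∘tabulate _ (π ⟨$⟩ʳ i) ⟩
  lookup x (π ⟨$⟩ˡ (π ⟨$⟩ʳ i))                     ≡⟨ cong (lookup x) (inverseˡ π) ⟩
  lookup x i                                      ∎

-- Position `j` of the permuted word reads position `π j` of `x`, so it sees the flipped bit. Any
-- other position `k` reads `π k`, which differs from `π j` because `π` is injective, so it sees an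
-- unchanged bit.
permute-flip : ∀ {n} (π : Permutation′ n) x j →
  permute π (flip x (π ⟨$⟩ʳ j)) ≡ flip (permute π x) j
permute-flip π x j = lookup-extensional λ k → trans (lookup∘tabulate _ k) (at k)
  where
  at : ∀ k → lookup (flip x (π ⟨$⟩ʳ j)) (π ⟨$⟩ʳ k) ≡ lookup (flip (permute π x) j) k
  at k with k Fin.≟ j
  ... | yes refl = begin
    lookup (flip x (π ⟨$⟩ʳ k)) (π ⟨$⟩ʳ k)  ≡⟨ lookup∘updateAt (π ⟨$⟩ʳ k) x ⟩
    not (lookup x (π ⟨$⟩ʳ k))              ≡⟨ cong not (lookup∘tabulate _ k) ⟨
    not (lookup (permute π x) k)          ≡⟨ lookup∘updateAt k (permute π x) ⟨
    lookup (flip (permute π x) k) k       ∎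
  ... | no k≢j = begin
    lookup (flip x (π ⟨$⟩ʳ j)) (π ⟨$⟩ʳ k)
      ≡⟨ lookup∘updateAt′ _ _ (k≢j ∘ Injection.injective (↔⇒↣ π)) x ⟩
    lookup x (π ⟨$⟩ʳ k)
      ≡⟨ lookup∘tabulate _ k ⟨
    lookup (permute π x) k
      ≡⟨ lookup∘updateAt′ k j k≢j (permute π x) ⟨
    lookup (flip (permute π x) j) k ∎

module _ {n} (π : Permutation′ n) (ν : Word n) where

  transform : Word n → Word n
  transform x = permute π (negate ν x)

  untransform : Word n → Word n
  untransform y = negate ν (permute (Perm.flip π) y)

  transform-injective : Injective _≡_ _≡_ transform
  transform-injective {x} {y} eq = begin
    x                          ≡⟨ retract x ⟨
    untransform (transform x)  ≡⟨ cong untransform eq ⟩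
    untransform (transform y)  ≡⟨ retract y ⟩
    y                          ∎
    where
    retract : ∀ x → untransform (transform x) ≡ x
    -- Applying the right-inverse lemma to the inverse permutation gives the left inverse, because
    -- `Perm.flip (Perm.flip π)` acts as `π` by computation.
    retract x = trans (cong (negate ν) (permute-inverseʳ (Perm.flip π) (negate ν x)))
                      (negate-involutive ν x)

  transform-surjective : StrictlySurjective _≡_ transform
  transform-surjective y = untransform y ,
    trans (cong (permute π) (negate-involutive ν _)) (permute-inverseʳ π y)

  transform-flip : ∀ x j → transform (flip x (π ⟨$⟩ʳ j)) ≡ flip (transform x) j
  transform-flip x j =
    trans (cong (permute π) (negate-flip ν x (π ⟨$⟩ʳ j))) (permute-flip π (negate ν x) j)

  sensitivity-transform : ∀ {f g : BooleanFunction n} → f ∘ transform ≗ g →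
    ∀ x → sensitivity f (transform x) ≡ sensitivity g x
  sensitivity-transform {f} {g} f∘T≗g x = begin
    sensitivity f (transform x)
      ≡⟨ sensitivity-∑ f (transform x) ⟩
    ∑ (λ j → differ (f (transform x)) (f (flip (transform x) j)))
      -- Direction `j` at `transform x` corresponds to direction `π j` at `x`: pulling the flip back
      -- through `transform` leaves `f` applied to an image of `transform`, where it agrees with
      -- `g`.
      ≡⟨ sum-cong-≗ (λ j → cong₂ differ (f∘T≗g x)
           (trans (cong f (sym (transform-flip x j))) (f∘T≗g _))) ⟩
    ∑ (λ j → differ (g x) (g (flip x (π ⟨$⟩ʳ j))))
      ≡⟨ sum-permute (λ i → differ (g x) (g (flip x i))) π ⟨
    ∑ (λ i → differ (g x) (g (flip x i)))
      ≡⟨ sensitivity-∑ g x ⟨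
    sensitivity g x ∎

mainTheorem5 : (n : ℕ) (f g : BooleanFunction n) →
    PNEquivalent f g → averageSensitivity f ≡ averageSensitivity g
mainTheorem5 n f g (π , ν , f∘T≗g) =
  -- Both averages have the denominator `2 ^ n`, so equal numerators suffice. The nonzero proof is
  -- passed explicitly to match the one in `averageSensitivity`.
  cong (λ m → (+ m / (2 ^ n)) {{m^n≢0 2 n}}) (begin
    sum (List.map (sensitivity f) (words n))
      -- Used from right to left: the words are replaced by their images under `transform`, which
      -- only reorders the summands.
      ≡⟨ sum-↭ (↭.map⁺ (sensitivity f)
           (map-words-↭ (transform-injective π ν) (transform-surjective π ν))) ⟨
    sum (List.map (sensitivity f) (List.map (transform π ν) (words n)))
      ≡⟨ cong sum (List.map-∘ (words n)) ⟨
    sum (List.map (sensitivity f ∘ transform π ν) (words n))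
      ≡⟨ cong sum (List.map-cong (sensitivity-transform π ν {f} {g} f∘T≗g) (words n)) ⟩
    sum (List.map (sensitivity g) (words n)) ∎)
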